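{- Let $q$ be a power of an odd prime and let $n$ be a positive integer with $\gcd\big(n,\frac{q-1}{2}\big)=1$. Then the number of elements $a\in\mathbb{F}_q$ for which the binomial $x^n\big(x^{\frac{q-1}{2}}+a\big)$ is a permutation polynomial of $\mathbb{F}_q$ equals $$\frac{q-2+(-1)^n}{2}.$$
   Context: A polynomial $f\in\mathbb{F}_q[x]$ is a permutation polynomial of $\mathbb{F}_q$ if the map $c\mapsto f(c)$ is a bijection of $\mathbb{F}_q$. -}

module Defs where

open import Algebra.Bundles using (CommutativeRing)
open import Algebra.Definitions using (Invertible)
open import Data.Fin.Base using (Fin)
open import Data.List.Base using (List; []; _∷_; map)
open import Data.Nat.Base using (ℕ; zero; suc)
open import Data.Product.Base using (Σ; proj₁)
open import Function.Bundles using (Inverse)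
open import Function.Definitions using (Bijective)
open import Level using (Level; _⊔_)
open import Relation.Binary.Bundles using (Setoid)
import Relation.Binary.Construct.On as On
import Relation.Binary.PropositionalEquality as ≡
open import Relation.Nullary.Negation using (¬_)

record IsField {c ℓ : Level} (R : CommutativeRing c ℓ) : Set (c ⊔ ℓ) where
  open CommutativeRing R
  field
    1≉0     : ¬ (1# ≈ 0#)
    inverse : ∀ x → ¬ (x ≈ 0#) → Invertible _≈_ 1# _*_ x

-- Elements are counted up to the setoid's equality.
HasCardinality : {c ℓ : Level} → Setoid c ℓ → ℕ → Set (c ⊔ ℓ)
HasCardinality S n = Inverse S (≡.setoid (Fin n))

-- Equality ignores the proof component, so each element satisfying P is
-- counted exactly once.
Subsetoid : {c ℓ p : Level} (S : Setoid c ℓ) →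
            (Setoid.Carrier S → Set p) → Setoid (c ⊔ p) ℓ
Subsetoid S P = On.setoid S (proj₁ {B = P})

module Polynomials {c ℓ : Level} (R : CommutativeRing c ℓ) where
  open CommutativeRing R

  -- Coefficient lists, constant term first: a₀ ∷ a₁ ∷ … stands for
  -- a₀ + a₁ x + ….  Trailing zeros are allowed, so a polynomial has many
  -- representatives; evaluation does not depend on the choice.
  Polynomial : Set c
  Polynomial = List Carrier

  infixl 6 _⊕_
  infixl 7 _⊗_
  infixr 8 _↑_

  const : Carrier → Polynomial
  const a = a ∷ []

  X : Polynomial
  X = 0# ∷ 1# ∷ []

  _⊕_ : Polynomial → Polynomial → Polynomial
  []      ⊕ g       = g
  (a ∷ f) ⊕ []      = a ∷ f
  (a ∷ f) ⊕ (b ∷ g) = (a + b) ∷ (f ⊕ g)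

  _⊗_ : Polynomial → Polynomial → Polynomial
  []      ⊗ g = []
  (a ∷ f) ⊗ g = map (a *_) g ⊕ (0# ∷ (f ⊗ g))

  _↑_ : Polynomial → ℕ → Polynomial
  f ↑ zero  = const 1#
  f ↑ suc k = f ⊗ (f ↑ k)

  eval : Polynomial → Carrier → Carrier
  eval []      x = 0#
  eval (a ∷ f) x = a + x * eval f x

  IsPermutationPolynomial : Polynomial → Set (c ⊔ ℓ)
  IsPermutationPolynomial f = Bijective _≈_ _≈_ (eval f)

{-# OPTIONS --safe #-}
module Submission where

-- Let m = (q − 1)/2 and χ x = x ^ m, which is ±1 off zero.  On the class χ x = s
-- the binomial equals xⁿ (s + a), and x ↦ xⁿ is injective on each class because
-- gcd n m = 1.  Comparing the images of the two classes shows that the binomial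
-- permutes the field iff χ ((1 + a) (−1 + a)) = −(−1)ⁿ.  For a ≠ 1 the left side
-- is χ of the Möbius image (a + 1)/(a − 1), so the solutions are counted by the m
-- elements of the class χ = −(−1)ⁿ, except that t = 1, the image of no a ≠ 1,
-- has to be removed when −(−1)ⁿ = 1.

open import Defs
open import Algebra.Bundles using (CommutativeMonoid; CommutativeRing)
import Algebra.Properties.CommutativeMonoid.Sum as Sum
import Algebra.Properties.CommutativeSemiring.Exp as Exp
import Algebra.Properties.Ring as RingProperties
import Algebra.Properties.Semiring.Mult as Mult
import Algebra.Solver.Ring.NaturalCoefficients.Default as Solver
open import Data.Fin.Base using (Fin; zero; suc; punchIn; punchOut; inject≤)
import Data.Fin.Properties as Fin
open import Data.Integer.Base as ℤ using (+_; -1ℤ)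
import Data.Integer.Properties as ℤ
open import Data.List.Base using ([]; _∷_; length; map)
open import Data.Nat.Base as ℕ using (ℕ; zero; suc; _∸_; _≥_; s≤s; z≤n)
open import Data.Nat.Divisibility using (_∣_; ∣1⇒≡1; m%n≡0⇒n∣m)
open import Data.Nat.DivMod using (m*n/n≡m; m%n<n; m≡m%n+[m/n]*n)
open import Data.Nat.GCD using (gcd; GCD; gcd-GCD; module Bézout)
open import Data.Nat.Primality using (Prime; euclidsLemma; prime[2])
import Data.Nat.Properties as ℕ
open import Data.Nat.Solver using (module +-*-Solver)
open import Data.Product.Base using (∃; ∃-syntax; ∃₂; _×_; _,_; proj₁; proj₂)
open import Data.Rational.Base as ℚ using ()
import Data.Rational.Properties as ℚ
open import Data.Rational.Unnormalised.Base using (mkℚᵘ; *≡*)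
open import Data.Sum.Base using (_⊎_; inj₁; inj₂; [_,_]′)
open import Function.Base using (_∘_; id)
open import Function.Bundles using (Inverse)
import Function.Construct.Composition as Composition
import Function.Construct.Symmetry as Symmetry
open import Function.Definitions using (Injective; Surjective; Congruent)
open import Level using (Level)
open import Relation.Binary.Bundles using (Setoid)
open import Relation.Binary.PropositionalEquality as ≡ using (_≡_)
import Relation.Binary.Reasoning.Setoid as SetoidReasoning
open import Relation.Nullary.Decidable using (Dec; yes; no; map′; _×-dec_; _⊎-dec_)
open import Relation.Nullary.Negation using (¬_; contradiction)
open import Relation.Unary using (Decidable)

-- Counting in finite setoids

-- The split into classes is forced: `n` may be even when `m` is odd, and then `x` and `-x` have the
-- same n-th power, so xⁿ is not injective on all nonzero elements. Coprimality to `m` controls it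
-- only where χ is fixed. One device recurs in the global facts: a sum or product over the whole
-- field is unchanged when reindexed along a bijection. Translation by 1 yields 2 ≠ 0, scaling
-- yields Fermat's theorem and the equal size of the two classes, and the Möbius map turns the
-- criterion into the size of a class.

𝟙 : ∀ {p} {P : Set p} → Dec P → ℕ
𝟙 (yes _) = 1
𝟙 (no _)  = 0

𝟙-cong : ∀ {p r} {P : Set p} {R : Set r} (P? : Dec P) (R? : Dec R) →
         (P → R) → (R → P) → 𝟙 P? ≡ 𝟙 R?
𝟙-cong (yes _) (yes _) _ _ = ≡.refl
𝟙-cong (yes p) (no ¬r) f _ = contradiction (f p) ¬r
𝟙-cong (no ¬p) (yes r) _ g = contradiction (g r) ¬p
𝟙-cong (no _)  (no _)  _ _ = ≡.refl

𝟙-no : ∀ {p} {P : Set p} (P? : Dec P) → ¬ P → 𝟙 P? ≡ 0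
𝟙-no (yes p) ¬p = contradiction p ¬p
𝟙-no (no _)  _  = ≡.refl

𝟙-yes : ∀ {p} {P : Set p} (P? : Dec P) → P → 𝟙 P? ≡ 1
𝟙-yes (yes _) _ = ≡.refl
𝟙-yes (no ¬p) p = contradiction p ¬p

private module ℕSum = Sum ℕ.+-0-commutativeMonoid

-- `P` need not have unique proofs: equality on the subset ignores them, so `from` may return
-- whichever proof the decision procedure found.
Fin-subset-cardinality :
  ∀ {p} n {P : Fin n → Set p} (P? : Decidable P) →
  HasCardinality (Subsetoid (≡.setoid (Fin n)) P) (ℕSum.sum (λ i → 𝟙 (P? i)))
Fin-subset-cardinality zero P? = record
  { to = λ () ; from = λ () ; to-cong = λ { {() , _} } ; from-cong = λ { {()} }
  ; inverse = (λ { {()} }) , (λ { {() , _} }) }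
Fin-subset-cardinality (suc n) {P} P?
  with P? zero | Fin-subset-cardinality n (λ i → P? (suc i))
... | yes p₀ | rest = record
  { to = to′ ; from = from′
  ; to-cong   = λ {x} {y} → to′-cong {x} {y}
  ; from-cong = λ { ≡.refl → ≡.refl }
  ; inverse   = (λ {x} {y} → inverseˡ′ {x} {y}) , (λ {x} {y} → inverseʳ′ {x} {y}) }
  where
  open Inverse rest
  to′ : ∃ P → Fin (suc _)
  to′ (zero  , _) = zero
  to′ (suc i , p) = suc (to (i , p))
  from′ : Fin (suc _) → ∃ P
  from′ zero    = zero , p₀
  from′ (suc k) = suc (proj₁ (from k)) , proj₂ (from k)
  to′-cong : ∀ {x y : ∃ P} → proj₁ x ≡ proj₁ y → to′ x ≡ to′ y
  to′-cong {zero  , _} {zero   , _} ≡.refl = ≡.refl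
  to′-cong {suc i , _} {suc .i , _} ≡.refl = ≡.cong suc (to-cong ≡.refl)
  inverseˡ′ : ∀ {k} {x : ∃ P} → proj₁ x ≡ proj₁ (from′ k) → to′ x ≡ k
  inverseˡ′ {zero}  {zero  , _} _      = ≡.refl
  inverseˡ′ {suc k} {suc _ , _} ≡.refl = ≡.cong suc (inverseˡ ≡.refl)
  inverseʳ′ : ∀ {x : ∃ P} {k} → k ≡ to′ x → proj₁ (from′ k) ≡ proj₁ x
  inverseʳ′ {zero  , _} ≡.refl = ≡.refl
  inverseʳ′ {suc i , _} ≡.refl = ≡.cong suc (inverseʳ ≡.refl)
... | no ¬p₀ | rest = record
  { to = to′ ; from = from′
  ; to-cong   = λ {x} {y} → to′-cong {x} {y}
  ; from-cong = λ { ≡.refl → ≡.refl }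
  ; inverse   = (λ {x} {y} → inverseˡ′ {x} {y}) , (λ {x} {y} → inverseʳ′ {x} {y}) }
  where
  open Inverse rest
  to′ : ∃ P → Fin _
  to′ (zero  , p) = contradiction p ¬p₀
  to′ (suc i , p) = to (i , p)
  from′ : Fin _ → ∃ P
  from′ k = suc (proj₁ (from k)) , proj₂ (from k)
  to′-cong : ∀ {x y : ∃ P} → proj₁ x ≡ proj₁ y → to′ x ≡ to′ y
  to′-cong {zero  , p} {_}          _      = contradiction p ¬p₀
  to′-cong {suc i , _} {suc .i , _} ≡.refl = to-cong ≡.refl
  inverseˡ′ : ∀ {k} {x : ∃ P} → proj₁ x ≡ proj₁ (from′ k) → to′ x ≡ k
  inverseˡ′ {k} {suc _ , _} ≡.refl = inverseˡ ≡.refl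
  inverseʳ′ : ∀ {x : ∃ P} {k} → k ≡ to′ x → proj₁ (from′ k) ≡ proj₁ x
  inverseʳ′ {zero  , p} _      = contradiction p ¬p₀
  inverseʳ′ {suc i , _} ≡.refl = ≡.cong suc (inverseʳ ≡.refl)

-- Pigeonhole: if `j` is missed, deleting it from the codomain with `punchOut` leaves an injection
-- of `Fin (suc n)` into `Fin n`.
Fin-injective⇒surjective : ∀ {n} (f : Fin n → Fin n) →
                           Injective _≡_ _≡_ f → ∀ j → ∃ λ i → f i ≡ j
Fin-injective⇒surjective {suc n} f inj j with Fin.any? (λ i → f i Fin.≟ j)
... | yes hit = hit
... | no miss = contradiction (Fin.injective⇒≤ avoid-injective) ℕ.1+n≰n
  where
  missed : ∀ i → ¬ j ≡ f i
  missed i j≡fi = miss (i , ≡.sym j≡fi)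
  avoid : Fin (suc n) → Fin n
  avoid i = punchOut (missed i)
  avoid-injective : Injective _≡_ _≡_ avoid
  avoid-injective {x} {y} eq = inj (Fin.punchOut-injective (missed x) (missed y) eq)

module FiniteSetoid {a b} {S : Setoid a b} {q} (card : HasCardinality S q) where
  open Setoid S renaming (Carrier to A)
  open Inverse card

  from∘to : ∀ x → from (to x) ≈ x
  from∘to = strictlyInverseʳ

  to-injective : Injective _≈_ _≡_ to
  to-injective {x} {y} eq = trans (sym (from∘to x)) (trans (from-cong eq) (from∘to y))

  from-injective : Injective _≡_ _≈_ from
  from-injective {i} {j} eq =
    ≡.trans (≡.sym (strictlyInverseˡ i)) (≡.trans (to-cong eq) (strictlyInverseˡ j))

  infix 4 _≟_
  _≟_ : ∀ x y → Dec (x ≈ y)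
  x ≟ y = map′ to-injective to-cong (to x Fin.≟ to y)

  count : ∀ {p} {P : A → Set p} → Decidable P → ℕ
  count P? = ℕSum.sum (λ i → 𝟙 (P? (from i)))

  subset-cardinality :
    ∀ {p} {P : A → Set p} (P? : Decidable P) → (∀ {x y} → x ≈ y → P x → P y) →
    HasCardinality (Subsetoid S P) (count P?)
  subset-cardinality P? resp = Composition.inverse
    (record
      { to        = λ (x , p) → to x , resp (sym (from∘to x)) p
      ; from      = λ (i , p) → from i , p
      ; to-cong   = to-cong
      ; from-cong = from-cong
      ; inverse   = inverseˡ , inverseʳ })
    (Fin-subset-cardinality q (λ i → P? (from i)))

  injective⇒surjective : ∀ f → Congruent _≈_ _≈_ f → Injective _≈_ _≈_ f →
                         Surjective _≈_ _≈_ f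
  injective⇒surjective f f-cong inj y
    with Fin-injective⇒surjective (to ∘ f ∘ from)
           (λ eq → from-injective (inj (to-injective eq))) (to y)
  ... | i , eq = from i , λ z≈ → trans (f-cong z≈) (to-injective eq)

-- The monoid is a parameter because three are needed: field multiplication for Fermat's theorem,
-- field addition for 2 ≠ 0, and addition in ℕ for counting.
module FiniteSum {a b} {S : Setoid a b} {r} (card : HasCardinality S (suc r))
                 {c d} (M : CommutativeMonoid c d) where
  open Setoid S renaming (Carrier to A)
  open Inverse card
  open FiniteSetoid card
  private module M = CommutativeMonoid M
  open Sum M public using (sum)
  open Sum M hiding (sum)

  ∑ᴬ : (A → M.Carrier) → M.Carrier
  ∑ᴬ g = sum (g ∘ from)

  ∑ᴬ-cong : ∀ {g h} → (∀ x → g x M.≈ h x) → ∑ᴬ g M.≈ ∑ᴬ h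
  ∑ᴬ-cong g≈h = sum-cong-≋ (g≈h ∘ from)

  ∑ᴬ-distrib : ∀ g h → ∑ᴬ (λ x → g x M.∙ h x) M.≈ ∑ᴬ g M.∙ ∑ᴬ h
  ∑ᴬ-distrib g h = ∑-distrib-+ (g ∘ from) (h ∘ from)

  ∑ᴬ-reindex : ∀ g → Congruent _≈_ M._≈_ g → (h : Inverse S S) →
               ∑ᴬ g M.≈ ∑ᴬ (g ∘ Inverse.to h)
  ∑ᴬ-reindex g g-cong h = M.trans
    (sum-permute (g ∘ from)
      (Composition.inverse (Symmetry.inverse card) (Composition.inverse h card)))
    (sum-cong-≋ (λ i → g-cong (from∘to (Inverse.to h (from i)))))

  ∑ᴬ-split : ∀ g → Congruent _≈_ M._≈_ g → ∀ b k → (∀ y → ¬ y ≈ b → g y M.≈ k) →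
             ∑ᴬ g M.≈ g b M.∙ sum {r} (λ _ → k)
  ∑ᴬ-split g g-cong b k off = M.trans
    (sum-remove {i = to b} (g ∘ from))
    (M.∙-cong (g-cong (from∘to b))
      (sum-cong-≋ (λ j → off _ (λ eq →
        Fin.punchInᵢ≢i (to b) j (≡.trans (≡.sym (strictlyInverseˡ _)) (to-cong eq))))))

count≡∑ᴬ : ∀ {a b p} {S : Setoid a b} {r} (card : HasCardinality S (suc r))
           {P : Setoid.Carrier S → Set p} (P? : Decidable P) →
           FiniteSetoid.count card P? ≡ FiniteSum.∑ᴬ card ℕ.+-0-commutativeMonoid (λ x → 𝟙 (P? x))
count≡∑ᴬ card P? = ≡.refl

-- Polynomials over a field

module PolynomialEvaluation {c ℓ} (R : CommutativeRing c ℓ) where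
  open CommutativeRing R hiding (zero)
  open Polynomials R
  open Exp commutativeSemiring
  open Solver commutativeSemiring using (solve; con; _:=_; _:+_; _:*_)
  open SetoidReasoning setoid

  eval-congʳ : ∀ f {x y} → x ≈ y → eval f x ≈ eval f y
  eval-congʳ []      x≈y = refl
  eval-congʳ (a ∷ f) x≈y = +-congˡ (*-cong x≈y (eval-congʳ f x≈y))

  eval-⊕ : ∀ f g x → eval (f ⊕ g) x ≈ eval f x + eval g x
  eval-⊕ []      g       x = sym (+-identityˡ _)
  eval-⊕ (a ∷ f) []      x = sym (+-identityʳ _)
  eval-⊕ (a ∷ f) (b ∷ g) x = trans
    (+-congˡ (*-congˡ (eval-⊕ f g x)))
    (solve 5 (λ a b x u v → (a :+ b) :+ x :* (u :+ v) := (a :+ x :* u) :+ (b :+ x :* v))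
      refl a b x (eval f x) (eval g x))

  eval-scale : ∀ a f x → eval (map (a *_) f) x ≈ a * eval f x
  eval-scale a []      x = sym (zeroʳ a)
  eval-scale a (b ∷ f) x = trans
    (+-congˡ (*-congˡ (eval-scale a f x)))
    (solve 4 (λ a b x u → a :* b :+ x :* (a :* u) := a :* (b :+ x :* u))
      refl a b x (eval f x))

  eval-⊗ : ∀ f g x → eval (f ⊗ g) x ≈ eval f x * eval g x
  eval-⊗ []      g x = sym (zeroˡ _)
  eval-⊗ (a ∷ f) g x = begin
    eval (map (a *_) g ⊕ (0# ∷ (f ⊗ g))) x        ≈⟨ eval-⊕ (map (a *_) g) _ x ⟩
    eval (map (a *_) g) x + (0# + x * eval (f ⊗ g) x)
      ≈⟨ +-cong (eval-scale a g x) (+-congˡ (*-congˡ (eval-⊗ f g x))) ⟩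
    a * eval g x + (0# + x * (eval f x * eval g x))
      ≈⟨ solve 4 (λ a x u v → a :* v :+ (con 0 :+ x :* (u :* v)) := (a :+ x :* u) :* v)
           refl a x (eval f x) (eval g x) ⟩
    (a + x * eval f x) * eval g x                 ∎

  eval-const : ∀ a x → eval (const a) x ≈ a
  eval-const a x = trans (+-congˡ (zeroʳ x)) (+-identityʳ a)

  eval-X : ∀ x → eval X x ≈ x
  eval-X x = trans (+-identityˡ _) (trans (*-congˡ (eval-const 1# x)) (*-identityʳ x))

  eval-↑ : ∀ f k x → eval (f ↑ k) x ≈ eval f x ^ k
  eval-↑ f zero    x = eval-const 1# x
  eval-↑ f (suc k) x = trans (eval-⊗ f (f ↑ k) x) (*-congˡ (eval-↑ f k x))

  eval-X↑ : ∀ k x → eval (X ↑ k) x ≈ x ^ k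
  eval-X↑ k x = trans (eval-↑ X k x) (^-congˡ k (eval-X x))

  eval-binomial : ∀ n m a x → eval (X ↑ n ⊗ (X ↑ m ⊕ const a)) x ≈ x ^ n * (x ^ m + a)
  eval-binomial n m a x = trans (eval-⊗ (X ↑ n) _ x) (*-cong (eval-X↑ n x)
    (trans (eval-⊕ (X ↑ m) _ x) (+-cong (eval-X↑ m x) (eval-const a x))))

  -- Synthetic division: the coefficients are the values at `r` of the successive tails. What gets
  -- divided is x f(x) - r f(r), hence a result as long as `f` itself.
  quotient : Polynomial → Carrier → Polynomial
  quotient []      r = []
  quotient (b ∷ f) r = eval (b ∷ f) r ∷ quotient f r

  length-quotient : ∀ f r → length (quotient f r) ≡ length f
  length-quotient []      r = ≡.refl
  length-quotient (b ∷ f) r = ≡.cong suc (length-quotient f r)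

  -- x f(x) − r f(r) is (x − r) times the quotient, with x = r + d so that no
  -- subtraction occurs.
  quotient-factor : ∀ f r d →
    (r + d) * eval f (r + d) ≈ r * eval f r + d * eval (quotient f r) (r + d)
  quotient-factor [] r d =
    solve 2 (λ r d → (r :+ d) :* con 0 := r :* con 0 :+ d :* con 0) refl r d
  quotient-factor (b ∷ f) r d = trans
    (*-congˡ (+-congˡ (quotient-factor f r d)))
    (solve 5 (λ r d b u v → (r :+ d) :* (b :+ (r :* u :+ d :* v)) :=
                            r :* (b :+ r :* u) :+ d :* ((b :+ r :* u) :+ (r :+ d) :* v))
      refl r d b (eval f r) (eval (quotient f r) (r + d)))

  monomial : ℕ → Polynomial
  monomial zero    = const 1#
  monomial (suc k) = 0# ∷ monomial k

  length-monomial : ∀ k → length (monomial k) ≡ suc k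
  length-monomial zero    = ≡.refl
  length-monomial (suc k) = ≡.cong suc (length-monomial k)

  eval-monomial : ∀ k x → eval (monomial k) x ≈ x ^ k
  eval-monomial zero    x = eval-const 1# x
  eval-monomial (suc k) x = trans (+-identityˡ _) (*-congˡ (eval-monomial k x))

module FieldProperties {c ℓ} (F : CommutativeRing c ℓ) (isField : IsField F)
         (_≟_ : ∀ x y → Dec (CommutativeRing._≈_ F x y)) where
  open CommutativeRing F hiding (zero)
  open IsField isField
  open RingProperties ring
  open Polynomials F
  open PolynomialEvaluation F
  open Exp commutativeSemiring
  open Solver commutativeSemiring using (solve; _:=_; _:*_)
  open SetoidReasoning setoid

  -- Junk value: inv 0 ≈ 0.
  inv : Carrier → Carrier
  inv x with x ≟ 0#
  ... | yes _  = 0#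
  ... | no x≉0 = proj₁ (inverse x x≉0)

  inv-inverseˡ : ∀ {x} → ¬ x ≈ 0# → inv x * x ≈ 1#
  inv-inverseˡ {x} x≉0 with x ≟ 0#
  ... | yes x≈0 = contradiction x≈0 x≉0
  ... | no x≉0′ = proj₁ (proj₂ (inverse x x≉0′))

  inv-zero : ∀ {x} → x ≈ 0# → inv x ≈ 0#
  inv-zero {x} x≈0 with x ≟ 0#
  ... | yes _  = refl
  ... | no x≉0 = contradiction x≈0 x≉0

  *-cancelʳ : ∀ {x y z} → ¬ z ≈ 0# → x * z ≈ y * z → x ≈ y
  *-cancelʳ {x} {y} {z} z≉0 eq = begin
    x                ≈⟨ expand x ⟩
    x * z * inv z    ≈⟨ *-congʳ eq ⟩
    y * z * inv z    ≈⟨ expand y ⟨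
    y                ∎
    where
    expand : ∀ w → w ≈ w * z * inv z
    expand w = begin
      w                ≈⟨ *-identityʳ w ⟨
      w * 1#           ≈⟨ *-congˡ (inv-inverseˡ z≉0) ⟨
      w * (inv z * z)  ≈⟨ solve 3 (λ w z i → w :* (i :* z) := w :* z :* i) refl w z (inv z) ⟩
      w * z * inv z    ∎

  *-nonzero : ∀ {x y} → ¬ x ≈ 0# → ¬ y ≈ 0# → ¬ x * y ≈ 0#
  *-nonzero x≉0 y≉0 xy≈0 = x≉0 (*-cancelʳ y≉0 (trans xy≈0 (sym (zeroˡ _))))

  ^-nonzero : ∀ {x} k → ¬ x ≈ 0# → ¬ x ^ k ≈ 0#
  ^-nonzero zero    x≉0 = 1≉0
  ^-nonzero (suc k) x≉0 = *-nonzero x≉0 (^-nonzero k x≉0)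

  1^ : ∀ k → 1# ^ k ≈ 1#
  1^ zero    = refl
  1^ (suc k) = trans (*-identityˡ _) (1^ k)

  -- The inverse chosen by `IsField` may depend on the representative and on the proof of
  -- nonvanishing; congruence comes from uniqueness of inverses.
  inv-cong : Congruent _≈_ _≈_ inv
  inv-cong {x} {y} x≈y with y ≟ 0#
  ... | yes y≈0 = inv-zero (trans x≈y y≈0)
  ... | no y≉0  = *-cancelʳ y≉0 (begin
    inv x * y                  ≈⟨ *-congˡ x≈y ⟨
    inv x * x                  ≈⟨ inv-inverseˡ (λ x≈0 → y≉0 (trans (sym x≈y) x≈0)) ⟩
    1#                         ≈⟨ proj₁ (proj₂ (inverse y y≉0)) ⟨
    proj₁ (inverse y y≉0) * y  ∎)

  inv-involutive : ∀ x → inv (inv x) ≈ x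
  inv-involutive x with x ≟ 0#
  ... | yes x≈0 = trans (inv-zero refl) (sym x≈0)
  ... | no x≉0  = *-cancelʳ i≉0 (begin
    inv i * i  ≈⟨ inv-inverseˡ i≉0 ⟩
    1#         ≈⟨ proj₂ (proj₂ (inverse x x≉0)) ⟨
    x * i      ∎)
    where
    i = proj₁ (inverse x x≉0)
    i≉0 : ¬ i ≈ 0#
    i≉0 i≈0 = 1≉0 (trans (sym (proj₂ (proj₂ (inverse x x≉0))))
                         (trans (*-congˡ i≈0) (zeroʳ x)))

  inversion : Inverse setoid setoid
  inversion = record
    { to = inv ; from = inv ; to-cong = inv-cong ; from-cong = inv-cong
    ; inverse = (λ eq → trans (inv-cong eq) (inv-involutive _))
              , (λ eq → trans (inv-cong eq) (inv-involutive _)) }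

  translation : Carrier → Inverse setoid setoid
  translation b = record
    { to = λ x → b + x ; from = λ x → - b + x ; to-cong = +-congˡ ; from-cong = +-congˡ
    ; inverse = (λ eq → trans (+-congˡ eq) (cancel (-‿inverseʳ b)))
              , (λ eq → trans (+-congˡ eq) (cancel (-‿inverseˡ b))) }
    where
    cancel : ∀ {b b′ x} → b + b′ ≈ 0# → b + (b′ + x) ≈ x
    cancel eq = trans (sym (+-assoc _ _ _)) (trans (+-congʳ eq) (+-identityˡ _))

  scaling : ∀ {b} → ¬ b ≈ 0# → Inverse setoid setoid
  scaling {b} b≉0 = record
    { to = λ x → b * x ; from = λ x → inv b * x ; to-cong = *-congˡ ; from-cong = *-congˡ
    ; inverse = (λ eq → trans (*-congˡ eq) (cancel (trans (*-comm _ _) (inv-inverseˡ b≉0))))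
              , (λ eq → trans (*-congˡ eq) (cancel (inv-inverseˡ b≉0))) }
    where
    cancel : ∀ {b b′ x} → b * b′ ≈ 1# → b * (b′ * x) ≈ x
    cancel eq = trans (sym (*-assoc _ _ _)) (trans (*-congʳ eq) (*-identityˡ _))

  x+[-x+y]≈y : ∀ x y → x + (- x + y) ≈ y
  x+[-x+y]≈y x y = trans (sym (+-assoc _ _ _)) (trans (+-congʳ (-‿inverseʳ x)) (+-identityˡ y))

  -x+y≈0⇒y≈x : ∀ x y → - x + y ≈ 0# → y ≈ x
  -x+y≈0⇒y≈x x y eq = begin
    y              ≈⟨ x+[-x+y]≈y x y ⟨
    x + (- x + y)  ≈⟨ +-congˡ eq ⟩
    x + 0#         ≈⟨ +-identityʳ x ⟩
    x              ∎

  -- Unless `x` is -1, the factor 1 + x can be cancelled from x (1 + x) = x + x² = 1 (1 + x).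
  x*x≈1⇒x≈±1 : ∀ x → x * x ≈ 1# → x ≈ 1# ⊎ x ≈ - 1#
  x*x≈1⇒x≈±1 x xx≈1 with x ≟ (- 1#)
  ... | yes x≈-1 = inj₂ x≈-1
  ... | no x≉-1  = inj₁ (*-cancelʳ {z = 1# + x} 1+x≉0 (begin
    x * (1# + x)    ≈⟨ distribˡ x 1# x ⟩
    x * 1# + x * x  ≈⟨ +-cong (*-identityʳ x) xx≈1 ⟩
    x + 1#          ≈⟨ +-comm x 1# ⟩
    1# + x          ≈⟨ *-identityˡ _ ⟨
    1# * (1# + x)   ∎))
    where
    1+x≉0 : ¬ 1# + x ≈ 0#
    1+x≉0 eq = x≉-1 (+-inverseʳ-unique 1# x eq)

  -- The root bound in a form without degrees or leading coefficients. Dividing out the root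
  -- `t zero` shortens the list by one, and the other points stay roots of the quotient because `t`
  -- is injective.
  eval-vanishes : ∀ k f → length f ≡ k → (t : Fin k → Carrier) → Injective _≡_ _≈_ t →
                  (∀ i → eval f (t i) ≈ 0#) → ∀ x → eval f x ≈ 0#
  eval-vanishes zero    []      _   t t-inj root x = refl
  eval-vanishes (suc k) (a ∷ f) len t t-inj root x = begin
    eval (a ∷ f) x                       ≈⟨ factor x ⟩
    (- r + x) * eval (quotient f r) x    ≈⟨ *-congˡ (quotient-vanishes x) ⟩
    (- r + x) * 0#                       ≈⟨ zeroʳ _ ⟩
    0#                                   ∎
    where
    r = t zero
    -- The values of `a ∷ f` at `x` and at `r` differ by x f(x) - r f(r), which is what
    -- `quotient-factor` factors, and the value at `r` is 0.
    factor : ∀ x → eval (a ∷ f) x ≈ (- r + x) * eval (quotient f r) x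
    factor x = begin
      a + x * eval f x              ≈⟨ +-congˡ (*-cong x≈r+d (eval-congʳ f x≈r+d)) ⟩
      a + (r + d) * eval f (r + d)  ≈⟨ +-congˡ (quotient-factor f r d) ⟩
      a + (r * eval f r + d * eval (quotient f r) (r + d))
                                    ≈⟨ +-assoc _ _ _ ⟨
      (a + r * eval f r) + d * eval (quotient f r) (r + d)
                                    ≈⟨ +-congʳ (root zero) ⟩
      0# + d * eval (quotient f r) (r + d)
                                    ≈⟨ +-identityˡ _ ⟩
      d * eval (quotient f r) (r + d)
                                    ≈⟨ *-congˡ (eval-congʳ (quotient f r) x≈r+d) ⟨
      d * eval (quotient f r) x     ∎
      where
      d = - r + x
      x≈r+d : x ≈ r + d
      x≈r+d = sym (x+[-x+y]≈y r x)
    quotient-root : ∀ i → eval (quotient f r) (t (suc i)) ≈ 0#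
    quotient-root i = *-cancelʳ {z = - r + t (suc i)}
      (λ eq → contradiction (t-inj (-x+y≈0⇒y≈x _ _ eq)) λ ())
      (trans (*-comm _ _) (trans (sym (factor (t (suc i))))
        (trans (root (suc i)) (sym (zeroˡ _)))))
    quotient-vanishes : ∀ x → eval (quotient f r) x ≈ 0#
    quotient-vanishes = eval-vanishes k (quotient f r)
      (≡.trans (length-quotient f r) (ℕ.suc-injective len))
      (t ∘ suc) (λ eq → Fin.suc-injective (t-inj eq)) quotient-root

sum-ones : ∀ n → ℕSum.sum {n} (λ _ → 1) ≡ n
sum-ones zero    = ≡.refl
sum-ones (suc n) = ≡.cong suc (sum-ones n)

-- Finite fields of odd order

module OddFiniteField {c ℓ} (F : CommutativeRing c ℓ) (isField : IsField F) (m′ : ℕ)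
         (card : HasCardinality (CommutativeRing.setoid F) (suc (2 ℕ.* suc m′))) where
  open CommutativeRing F hiding (zero)
  open IsField isField using (1≉0)
  open RingProperties ring
  open FiniteSetoid card
  open FieldProperties F isField _≟_
  open Polynomials F
  open PolynomialEvaluation F
  open Exp commutativeSemiring
  open SetoidReasoning setoid hiding (step-≡-⟩; step-≡-⟨)
  private
    module Card = Inverse card
    module Π  = FiniteSum card *-commutativeMonoid
    module Σ₊ = FiniteSum card +-commutativeMonoid
    module #  = FiniteSum card ℕ.+-0-commutativeMonoid

  m : ℕ
  m = suc m′

  -- Adding 1 to every element leaves the sum of all elements unchanged, so q ones add up to 0. With
  -- q = 1 + 2m, the equation 2 = 0 would turn that sum into 1.
  2≉0 : ¬ 1# + 1# ≈ 0#
  2≉0 2≈0 = 1≉0 (begin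
    1#                              ≈⟨ +-identityʳ 1# ⟨
    1# + 0#                         ≈⟨ +-congˡ (zeroˡ _) ⟨
    1# + 0# * (m · 1#)             ≈⟨ +-congˡ (*-congʳ (trans (+-congˡ (+-identityʳ 1#)) 2≈0)) ⟨
    1# + (2 · 1#) * (m · 1#)      ≈⟨ +-congˡ (×1-homo-* 2 m) ⟨
    suc (2 ℕ.* m) · 1#             ≈⟨ Sum.sum-replicate +-commutativeMonoid (suc (2 ℕ.* m)) ⟨
    ones                            ≈⟨ ones≈0 ⟩
    0#                              ∎)
    where
    open Mult semiring using (×1-homo-*) renaming (_×_ to infixr 8 _·_)
    ones all : Carrier
    ones = Σ₊.∑ᴬ (λ _ → 1#)
    all  = Σ₊.∑ᴬ (λ x → x)
    ones≈0 : ones ≈ 0#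
    ones≈0 = +-cancelʳ all ones 0# (begin
      ones + all             ≈⟨ Σ₊.∑ᴬ-distrib (λ _ → 1#) (λ x → x) ⟨
      Σ₊.∑ᴬ (λ x → 1# + x)  ≈⟨ Σ₊.∑ᴬ-reindex (λ x → x) (λ eq → eq) (translation 1#) ⟨
      all                    ≈⟨ +-identityˡ all ⟨
      0# + all               ∎)

  1≉-1 : ¬ 1# ≈ - 1#
  1≉-1 eq = 2≉0 (trans (+-congˡ eq) (-‿inverseʳ 1#))

  -1≉0 : ¬ - 1# ≈ 0#
  -1≉0 eq = 1≉0 (trans (sym (+-identityʳ 1#)) (trans (+-congˡ (sym eq)) (-‿inverseʳ 1#)))

  -- Lets a product over the nonzero elements run over the whole field, with a neutral factor at
  -- zero.
  unlessZero : Carrier → Carrier → Carrier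
  unlessZero z y with y ≟ 0#
  ... | yes _ = 1#
  ... | no _  = z

  unlessZero-zero : ∀ z {y} → y ≈ 0# → unlessZero z y ≈ 1#
  unlessZero-zero z {y} y≈0 with y ≟ 0#
  ... | yes _  = refl
  ... | no y≉0 = contradiction y≈0 y≉0

  unlessZero-nonzero : ∀ z {y} → ¬ y ≈ 0# → unlessZero z y ≈ z
  unlessZero-nonzero z {y} y≉0 with y ≟ 0#
  ... | yes y≈0 = contradiction y≈0 y≉0
  ... | no _    = refl

  unlessZero-cong : ∀ {z z′ y y′} → z ≈ z′ → y ≈ y′ → unlessZero z y ≈ unlessZero z′ y′
  unlessZero-cong {z} {z′} {y} {y′} z≈z′ y≈y′ with y ≟ 0#
  ... | yes y≈0 = sym (unlessZero-zero z′ (trans (sym y≈y′) y≈0))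
  ... | no y≉0  = trans z≈z′ (sym (unlessZero-nonzero z′ (λ eq → y≉0 (trans y≈y′ eq))))

  product-nonzero : ∀ {k} (t : Fin k → Carrier) → (∀ i → ¬ t i ≈ 0#) → ¬ Π.sum t ≈ 0#
  product-nonzero {zero}  t t≉0 = 1≉0
  product-nonzero {suc k} t t≉0 = *-nonzero (t≉0 zero) (product-nonzero (t ∘ suc) (t≉0 ∘ suc))

  -- Multiplication by x permutes the nonzero elements, so it fixes their product.
  fermat : ∀ {x} → ¬ x ≈ 0# → x ^ (2 ℕ.* m) ≈ 1#
  fermat {x} x≉0 = begin
    x ^ (2 ℕ.* m)
      ≈⟨ Sum.sum-replicate *-commutativeMonoid (2 ℕ.* m) ⟨
    Π.sum {2 ℕ.* m} (λ _ → x)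
      ≈⟨ *-identityˡ _ ⟨
    1# * Π.sum {2 ℕ.* m} (λ _ → x)
      ≈⟨ *-congʳ (unlessZero-zero x refl) ⟨
    unlessZero x 0# * Π.sum {2 ℕ.* m} (λ _ → x)
      ≈⟨ Π.∑ᴬ-split (unlessZero x) (unlessZero-cong refl) 0# x
           (λ y y≉0 → unlessZero-nonzero x y≉0) ⟨
    Π.∑ᴬ (unlessZero x)
      ≈⟨ *-cancelʳ units≉0 (begin
           Π.∑ᴬ (unlessZero x) * Π.∑ᴬ unit           ≈⟨ Π.∑ᴬ-distrib (unlessZero x) unit ⟨
           Π.∑ᴬ (λ y → unlessZero x y * unit y)      ≈⟨ Π.∑ᴬ-cong multiply ⟩
           Π.∑ᴬ (λ y → unit (x * y))
             ≈⟨ Π.∑ᴬ-reindex unit (λ eq → unlessZero-cong eq eq) (scaling x≉0) ⟨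
           Π.∑ᴬ unit                                 ≈⟨ *-identityˡ _ ⟨
           1# * Π.∑ᴬ unit                            ∎) ⟩
    1# ∎
    where
    unit : Carrier → Carrier
    unit y = unlessZero y y
    unit≉0 : ∀ y → ¬ unit y ≈ 0#
    unit≉0 y eq with y ≟ 0#
    ... | yes _  = 1≉0 eq
    ... | no y≉0 = y≉0 eq
    units≉0 : ¬ Π.∑ᴬ unit ≈ 0#
    units≉0 = product-nonzero (unit ∘ Card.from) (λ i → unit≉0 (Card.from i))
    multiply : ∀ y → unlessZero x y * unit y ≈ unit (x * y)
    multiply y with y ≟ 0#
    ... | yes y≈0 = trans (*-identityˡ 1#)
                      (sym (unlessZero-zero _ (trans (*-congˡ y≈0) (zeroʳ x))))
    ... | no y≉0  = sym (unlessZero-nonzero _ (*-nonzero x≉0 y≉0))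

  -- The character χ and the sizes of its classes

  χ : Carrier → Carrier
  χ x = x ^ m

  χ-cong : Congruent _≈_ _≈_ χ
  χ-cong = ^-congˡ m

  χ-* : ∀ x y → χ (x * y) ≈ χ x * χ y
  χ-* x y = ^-distrib-* x y m

  χ-zero : ∀ {x} → x ≈ 0# → χ x ≈ 0#
  χ-zero x≈0 = trans (*-congʳ x≈0) (zeroˡ _)

  χ-nonzero⇒nonzero : ∀ {x s} → χ x ≈ s → ¬ s ≈ 0# → ¬ x ≈ 0#
  χ-nonzero⇒nonzero χx≈s s≉0 x≈0 = s≉0 (trans (sym χx≈s) (χ-zero x≈0))

  χ-square : ∀ {x} → ¬ x ≈ 0# → χ x * χ x ≈ 1#
  χ-square {x} x≉0 = begin
    x ^ m * x ^ m   ≈⟨ ^-homo-* x m m ⟨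
    x ^ (m ℕ.+ m)   ≈⟨ ^-congʳ x (≡.cong (m ℕ.+_) (≡.sym (ℕ.+-identityʳ m))) ⟩
    x ^ (2 ℕ.* m)   ≈⟨ fermat x≉0 ⟩
    1#              ∎

  χ≈±1 : ∀ {x} → ¬ x ≈ 0# → χ x ≈ 1# ⊎ χ x ≈ - 1#
  χ≈±1 {x} x≉0 = x*x≈1⇒x≈±1 (χ x) (χ-square x≉0)

  -- Off zero the values of χ are their own inverses, so under χ a quotient may be exchanged for a
  -- product.
  χ-inv : ∀ {x} → ¬ x ≈ 0# → χ (inv x) ≈ χ x
  χ-inv {x} x≉0 = *-cancelʳ (^-nonzero m x≉0) (begin
    χ (inv x) * χ x  ≈⟨ χ-* (inv x) x ⟨
    χ (inv x * x)    ≈⟨ χ-cong (inv-inverseˡ x≉0) ⟩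
    χ 1#             ≈⟨ 1^ m ⟩
    1#               ≈⟨ χ-square x≉0 ⟨
    χ x * χ x        ∎)

  -- The polynomial xᵐ - 1 has m + 1 coefficients. Vanishing at m + 1 points would make it vanish
  -- everywhere, but its value at 0 is -1.
  residues-bounded : (t : Fin (suc m) → Carrier) → Injective _≡_ _≈_ t →
                     ¬ (∀ i → χ (t i) ≈ 1#)
  residues-bounded t t-inj χt≈1 = -1≉0 (begin
    - 1#           ≈⟨ +-identityʳ _ ⟨
    - 1# + 0#      ≈⟨ +-congˡ (χ-zero refl) ⟨
    - 1# + χ 0#    ≈⟨ eval-χ-1 0# ⟨
    eval χ-1 0#    ≈⟨ eval-vanishes (suc m) χ-1 (≡.cong suc (length-monomial m′)) t t-inj
                        (λ i → trans (eval-χ-1 (t i))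
                          (trans (+-congˡ (χt≈1 i)) (-‿inverseˡ 1#))) 0# ⟩
    0#             ∎)
    where
    χ-1 : Polynomial
    χ-1 = - 1# ∷ monomial m′
    eval-χ-1 : ∀ x → eval χ-1 x ≈ - 1# + χ x
    eval-χ-1 x = +-congˡ (*-congˡ (eval-monomial m′ x))

  -- There are 2m nonzero elements, and 2m ≥ m + 1, so they cannot all be residues; a finite search
  -- then produces the witness.
  ∃-nonresidue : ∃ λ g → χ g ≈ - 1#
  ∃-nonresidue = nonresidue (Fin.¬∀⟶∃¬ (suc (2 ℕ.* m)) _
      (λ i → (Card.from i ≟ 0#) ⊎-dec (χ (Card.from i) ≟ 1#)) not-all)
    where
    1+m≤2m : suc m ℕ.≤ 2 ℕ.* m
    1+m≤2m = ℕ.≤-trans (ℕ.≤-reflexive (ℕ.+-comm 1 m)) (ℕ.+-monoʳ-≤ m (s≤s z≤n))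
    -- `punchIn` skips the index of zero, so these are m + 1 distinct nonzero elements.
    index : Fin (suc m) → Fin (suc (2 ℕ.* m))
    index j = punchIn (Card.to 0#) (inject≤ j 1+m≤2m)
    not-all : ¬ (∀ i → Card.from i ≈ 0# ⊎ χ (Card.from i) ≈ 1#)
    not-all all = residues-bounded (Card.from ∘ index)
      (λ eq → Fin.inject≤-injective 1+m≤2m 1+m≤2m _ _
        (Fin.punchIn-injective (Card.to 0#) _ _ (from-injective eq)))
      (λ j → [ (λ ≈0 → contradiction
                  (≡.trans (≡.sym (Card.strictlyInverseˡ (index j))) (Card.to-cong ≈0))
                  (Fin.punchInᵢ≢i (Card.to 0#) _))
             , id ]′ (all (index j)))
    nonresidue : (∃ λ i → ¬ (Card.from i ≈ 0# ⊎ χ (Card.from i) ≈ 1#)) → ∃ λ g → χ g ≈ - 1#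
    nonresidue (i , neither) =
      Card.from i , [ (λ ≈1 → contradiction (inj₂ ≈1) neither) , id ]′ (χ≈±1 (neither ∘ inj₁))

  #-≈ : ∀ b → #.∑ᴬ (λ x → 𝟙 (x ≟ b)) ≡ 1
  #-≈ b = ≡.trans
    (#.∑ᴬ-split (λ x → 𝟙 (x ≟ b))
      (λ {x} {y} x≈y → 𝟙-cong (x ≟ b) (y ≟ b) (trans (sym x≈y)) (trans x≈y))
      b 0 (λ y y≉b → 𝟙-no (y ≟ b) y≉b))
    (≡.cong₂ ℕ._+_ (𝟙-yes (b ≟ b) refl)
      (Sum.sum-replicate-zero ℕ.+-0-commutativeMonoid (2 ℕ.* m)))

  #χ≈ : Carrier → ℕ
  #χ≈ s = #.∑ᴬ (λ x → 𝟙 (χ x ≟ s))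

  𝟙-χ-cong : ∀ s → Congruent _≈_ _≡_ (λ x → 𝟙 (χ x ≟ s))
  𝟙-χ-cong s {x} {y} x≈y = 𝟙-cong (χ x ≟ s) (χ y ≟ s)
    (trans (sym (χ-cong x≈y))) (trans (χ-cong x≈y))

  -- Multiplication by a nonresidue `g` is a bijection of the field that changes the sign of χ.
  #residues≡#nonresidues : #χ≈ 1# ≡ #χ≈ (- 1#)
  #residues≡#nonresidues = ≡.sym (≡.trans
    (#.∑ᴬ-reindex _ (𝟙-χ-cong (- 1#)) (scaling g≉0))
    (#.∑ᴬ-cong (λ x → 𝟙-cong (χ (g * x) ≟ (- 1#)) (χ x ≟ 1#)
      (λ eq → *-cancelʳ -1≉0 (begin
        χ x * - 1#  ≈⟨ *-comm _ _ ⟩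
        - 1# * χ x  ≈⟨ χ[gx] x ⟨
        χ (g * x)   ≈⟨ eq ⟩
        - 1#        ≈⟨ *-identityˡ _ ⟨
        1# * - 1#   ∎))
      (λ eq → trans (χ[gx] x) (trans (*-congˡ eq) (*-identityʳ _))))))
    where
    g    = proj₁ ∃-nonresidue
    χg   = proj₂ ∃-nonresidue
    g≉0  = χ-nonzero⇒nonzero χg -1≉0
    χ[gx] : ∀ x → χ (g * x) ≈ - 1# * χ x
    χ[gx] x = trans (χ-* g x) (*-congʳ χg)

  𝟙-trichotomy : ∀ x → 𝟙 (x ≟ 0#) ℕ.+ (𝟙 (χ x ≟ 1#) ℕ.+ 𝟙 (χ x ≟ (- 1#))) ≡ 1
  𝟙-trichotomy x with x ≟ 0#
  ... | yes x≈0 = ≡.cong suc (≡.cong₂ ℕ._+_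
    (𝟙-no (χ x ≟ 1#)     (λ eq → 1≉0  (trans (sym eq) (χ-zero x≈0))))
    (𝟙-no (χ x ≟ (- 1#)) (λ eq → -1≉0 (trans (sym eq) (χ-zero x≈0)))))
  ... | no x≉0  = [
    (λ χx≈1 → ≡.cong₂ ℕ._+_
      (𝟙-yes (χ x ≟ 1#) χx≈1)
      (𝟙-no (χ x ≟ (- 1#)) (λ eq → 1≉-1 (trans (sym χx≈1) eq)))) ,
    (λ χx≈-1 → ≡.cong₂ ℕ._+_
      (𝟙-no (χ x ≟ 1#) (λ eq → 1≉-1 (trans (sym eq) χx≈-1)))
      (𝟙-yes (χ x ≟ (- 1#)) χx≈-1)) ]′ (χ≈±1 x≉0)

  -- Zero together with two classes of equal size exhausts the 1 + 2m elements.
  #residues≡m : #χ≈ 1# ≡ m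
  #residues≡m = ℕ.*-cancelˡ-≡ C m 2 (ℕ.suc-injective (begin′
    suc (2 ℕ.* C)                      ≡⟨ ≡.cong (λ k → suc (C ℕ.+ k)) (ℕ.+-identityʳ C) ⟩
    1 ℕ.+ (C ℕ.+ C)                    ≡⟨ ≡.cong₂ ℕ._+_ (≡.sym (#-≈ 0#))
                                            (≡.cong (C ℕ.+_) #residues≡#nonresidues) ⟩
    #.∑ᴬ Z ℕ.+ (C ℕ.+ #χ≈ (- 1#))      ≡⟨ ≡.cong (#.∑ᴬ Z ℕ.+_) (#.∑ᴬ-distrib R N) ⟨
    #.∑ᴬ Z ℕ.+ #.∑ᴬ (λ x → R x ℕ.+ N x)  ≡⟨ #.∑ᴬ-distrib Z (λ x → R x ℕ.+ N x) ⟨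
    #.∑ᴬ (λ x → Z x ℕ.+ (R x ℕ.+ N x))   ≡⟨ #.∑ᴬ-cong 𝟙-trichotomy ⟩
    #.∑ᴬ (λ _ → 1)                     ≡⟨ sum-ones (suc (2 ℕ.* m)) ⟩
    suc (2 ℕ.* m)                      ∎′))
    where
    open ≡.≡-Reasoning using (step-≡-⟩; step-≡-⟨) renaming (begin_ to begin′_; _∎ to _∎′)
    C = #χ≈ 1#
    Z R N : Carrier → ℕ
    Z x = 𝟙 (x ≟ 0#)
    R x = 𝟙 (χ x ≟ 1#)
    N x = 𝟙 (χ x ≟ (- 1#))

  #χ≈±1 : ∀ {s} → s ≈ 1# ⊎ s ≈ - 1# → #χ≈ s ≡ m
  #χ≈±1 {s} (inj₁ s≈1) = ≡.trans
    (#.∑ᴬ-cong (λ x → 𝟙-cong (χ x ≟ s) (χ x ≟ 1#)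
      (λ eq → trans eq s≈1) (λ eq → trans eq (sym s≈1))))
    #residues≡m
  #χ≈±1 {s} (inj₂ s≈-1) = ≡.trans
    (#.∑ᴬ-cong (λ x → 𝟙-cong (χ x ≟ s) (χ x ≟ (- 1#))
      (λ eq → trans eq s≈-1) (λ eq → trans eq (sym s≈-1))))
    (≡.trans (≡.sym #residues≡#nonresidues) #residues≡m)

-- Arithmetic of the exponent and of the final numerator

coprime⇒inverse-mod : ∀ n m′ → gcd n (suc m′) ≡ 1 →
  ∃ λ u → ∃₂ λ a b → u ℕ.* n ℕ.+ a ℕ.* suc m′ ≡ 1 ℕ.+ b ℕ.* suc m′
coprime⇒inverse-mod n m′ gcd≡1
  with Bézout.identity (≡.subst (GCD n (suc m′)) gcd≡1 (gcd-GCD n (suc m′)))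
... | Bézout.+- x y eq = x , 0 , y , ≡.trans (ℕ.+-identityʳ _) (≡.sym eq)
-- Here 1 + x n = y m, so -x inverts n modulo m. Since `m′` is congruent to -1 modulo `suc m′`, the
-- natural number `m′ * x` represents -x; the extra multiple of m on the left keeps the identity
-- free of subtraction.
... | Bézout.-+ x y eq = m′ ℕ.* x , 1 , m′ ℕ.* y , (begin
  m′ ℕ.* x ℕ.* n ℕ.+ 1 ℕ.* suc m′
    ≡⟨ solve 3 (λ k x n → k :* x :* n :+ con 1 :* (con 1 :+ k) :=
                          con 1 :+ k :* (con 1 :+ x :* n)) ≡.refl m′ x n ⟩
  1 ℕ.+ m′ ℕ.* (1 ℕ.+ x ℕ.* n)
    ≡⟨ ≡.cong (λ k → 1 ℕ.+ m′ ℕ.* k) eq ⟩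
  1 ℕ.+ m′ ℕ.* (y ℕ.* suc m′)
    ≡⟨ ≡.cong (1 ℕ.+_) (ℕ.*-assoc m′ y (suc m′)) ⟨
  1 ℕ.+ m′ ℕ.* y ℕ.* suc m′ ∎)
  where
  open ≡.≡-Reasoning
  open +-*-Solver

numerator : ℕ → ℤ.ℤ → ℤ.ℤ
numerator m i = (+ suc (2 ℕ.* m)) ℤ.- (+ 2) ℤ.+ i

-- Even and odd refer to the exponent `n`: the second argument of `numerator` is (-1)ⁿ, and the
-- counts are m and m - 1 respectively.
numerator-even : ∀ k → + (suc k ℕ.* 2) ≡ numerator (suc k) (+ 1)
numerator-even k = ≡.cong +_ (solve 1
  (λ k → (con 1 :+ k) :* con 2 := (k :+ (con 1 :+ (k :+ con 0))) :+ con 1) ≡.refl k)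
  where open +-*-Solver

numerator-odd : ∀ k → + (k ℕ.* 2) ≡ numerator (suc k) -1ℤ
numerator-odd k = ≡.cong (λ j → + j ℤ.+ -1ℤ) (solve 1
  (λ k → con 1 :+ k :* con 2 := k :+ (con 1 :+ (k :+ con 0))) ≡.refl k)
  where open +-*-Solver

module Binomial {c ℓ} (F : CommutativeRing c ℓ) (isField : IsField F) (m′ : ℕ)
         (card : HasCardinality (CommutativeRing.setoid F) (suc (2 ℕ.* suc m′)))
         (n′ : ℕ) (gcd≡1 : gcd (suc n′) (suc m′) ≡ 1) where
  open CommutativeRing F hiding (zero)
  open IsField isField using (1≉0)
  open RingProperties ring
  open FiniteSetoid card
  open FieldProperties F isField _≟_
  open OddFiniteField F isField m′ card
  open Polynomials F
  open PolynomialEvaluation F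
  open Exp commutativeSemiring
  open Solver commutativeSemiring using (solve; con; _:=_; _:+_; _:*_)
  open SetoidReasoning setoid hiding (step-≡-⟩; step-≡-⟨)
  private module # = FiniteSum card ℕ.+-0-commutativeMonoid

  n : ℕ
  n = suc n′

  -- The map xⁿ on the classes of χ

  ^-comm : ∀ x j k → (x ^ j) ^ k ≈ (x ^ k) ^ j
  ^-comm x j k = begin
    (x ^ j) ^ k      ≈⟨ ^-assocʳ x j k ⟩
    x ^ (j ℕ.* k)    ≈⟨ ^-congʳ x (ℕ.*-comm j k) ⟩
    x ^ (k ℕ.* j)    ≈⟨ ^-assocʳ x k j ⟨
    (x ^ k) ^ j      ∎

  private
    u a₀ b₀ : ℕ
    u  = proj₁ (coprime⇒inverse-mod n m′ gcd≡1)
    a₀ = proj₁ (proj₂ (coprime⇒inverse-mod n m′ gcd≡1))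
    b₀ = proj₁ (proj₂ (proj₂ (coprime⇒inverse-mod n m′ gcd≡1)))

  -- Recovers a nonzero `x` from xⁿ and χ x alone. This is the Bézout identity read in the exponent
  -- of `x`.
  bézout-power : ∀ x → (x ^ n) ^ u * χ x ^ a₀ ≈ x * χ x ^ b₀
  bézout-power x = begin
    (x ^ n) ^ u * χ x ^ a₀            ≈⟨ *-cong (power n u) (power m a₀) ⟩
    x ^ (u ℕ.* n) * x ^ (a₀ ℕ.* m)    ≈⟨ ^-homo-* x (u ℕ.* n) (a₀ ℕ.* m) ⟨
    x ^ (u ℕ.* n ℕ.+ a₀ ℕ.* m)
      ≈⟨ ^-congʳ x (proj₂ (proj₂ (proj₂ (coprime⇒inverse-mod n m′ gcd≡1)))) ⟩
    x * x ^ (b₀ ℕ.* m)                ≈⟨ *-congˡ (power m b₀) ⟨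
    x * χ x ^ b₀                      ∎
    where
    power : ∀ j k → (x ^ j) ^ k ≈ x ^ (k ℕ.* j)
    power j k = trans (^-assocʳ x j k) (^-congʳ x (ℕ.*-comm j k))

  ^n-injective : ∀ {x y} → ¬ y ≈ 0# → χ x ≈ χ y → x ^ n ≈ y ^ n → x ≈ y
  ^n-injective {x} {y} y≉0 χx≈χy xⁿ≈yⁿ = *-cancelʳ (^-nonzero b₀ (^-nonzero m y≉0)) (begin
    x * χ y ^ b₀             ≈⟨ *-congˡ (^-congˡ b₀ χx≈χy) ⟨
    x * χ x ^ b₀             ≈⟨ bézout-power x ⟨
    (x ^ n) ^ u * χ x ^ a₀   ≈⟨ *-cong (^-congˡ u xⁿ≈yⁿ) (^-congˡ a₀ χx≈χy) ⟩
    (y ^ n) ^ u * χ y ^ a₀   ≈⟨ bézout-power y ⟩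
    y * χ y ^ b₀             ∎)

  -- For a residue, exponents matter only modulo m, and there `u` inverts `n`; hence the root
  -- `w ^ u`.
  residue-root : ∀ {w} → χ w ≈ 1# → ∃ λ x → χ x ≈ 1# × x ^ n ≈ w
  residue-root {w} χw≈1 = w ^ u
    , trans (^-comm w u m) (trans (^-congˡ u χw≈1) (1^ u))
    , (begin
    (w ^ u) ^ n              ≈⟨ ^-comm w u n ⟩
    (w ^ n) ^ u              ≈⟨ *-identityʳ _ ⟨
    (w ^ n) ^ u * 1#         ≈⟨ *-congˡ (χw^k≈1 a₀) ⟨
    (w ^ n) ^ u * χ w ^ a₀   ≈⟨ bézout-power w ⟩
    w * χ w ^ b₀             ≈⟨ *-congˡ (χw^k≈1 b₀) ⟩
    w * 1#                   ≈⟨ *-identityʳ w ⟩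
    w                        ∎)
    where
    χw^k≈1 : ∀ k → χ w ^ k ≈ 1#
    χw^k≈1 k = trans (^-congˡ k χw≈1) (1^ k)

  -- The sign (-1)ⁿ in the field

  ε : Carrier
  ε = (- 1#) ^ n

  -1*-1≈1 : - 1# * - 1# ≈ 1#
  -1*-1≈1 = trans (-1*x≈-x (- 1#)) (-‿involutive 1#)

  -- Couples the sign in the field, which decides the count, with the sign in ℤ, which appears in
  -- the formula.
  sign : ∀ k → ((- 1#) ^ k ≈ 1# × -1ℤ ℤ.^ k ≡ + 1) ⊎ ((- 1#) ^ k ≈ - 1# × -1ℤ ℤ.^ k ≡ -1ℤ)
  sign zero    = inj₁ (refl , ≡.refl)
  sign (suc k) with sign k
  ... | inj₁ (eq , eqℤ) = inj₂ (trans (*-congˡ eq) (*-identityʳ _) , ≡.cong (-1ℤ ℤ.*_) eqℤ)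
  ... | inj₂ (eq , eqℤ) = inj₁ (trans (*-congˡ eq) -1*-1≈1 , ≡.cong (-1ℤ ℤ.*_) eqℤ)

  ε≈±1 : ε ≈ 1# ⊎ ε ≈ - 1#
  ε≈±1 = [ (λ (eq , _) → inj₁ eq) , (λ (eq , _) → inj₂ eq) ]′ (sign n)

  -ε≈±1 : - ε ≈ 1# ⊎ - ε ≈ - 1#
  -ε≈±1 = [ (λ eq → inj₂ (-‿cong eq))
          , (λ eq → inj₁ (trans (-‿cong eq) (-‿involutive 1#))) ]′ ε≈±1

  ε≉0 : ¬ ε ≈ 0#
  ε≉0 = ^-nonzero n -1≉0

  -ε≉0 : ¬ - ε ≈ 0#
  -ε≉0 = [ (λ eq ≈0 → 1≉0 (trans (sym eq) ≈0)) , (λ eq ≈0 → -1≉0 (trans (sym eq) ≈0)) ]′ -ε≈±1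

  ε≉-ε : ¬ ε ≈ - ε
  ε≉-ε eq = *-nonzero 2≉0 ε≉0 (begin
    (1# + 1#) * ε      ≈⟨ solve 1 (λ e → (con 1 :+ con 1) :* e := e :+ e) refl ε ⟩
    ε + ε              ≈⟨ +-congˡ eq ⟩
    ε + - ε            ≈⟨ -‿inverseʳ ε ⟩
    0#                 ∎)

  ε*ε≈1 : ε * ε ≈ 1#
  ε*ε≈1 = begin
    ε * ε               ≈⟨ ^-distrib-* (- 1#) (- 1#) n ⟨
    (- 1# * - 1#) ^ n   ≈⟨ ^-congˡ n -1*-1≈1 ⟩
    1# ^ n              ≈⟨ 1^ n ⟩
    1#                  ∎

  -- Since ε² = 1, applying the ±1 version to `x * ε` avoids a case split on the sign of `ε`.
  x*x≈1⇒x≈±ε : ∀ x → x * x ≈ 1# → x ≈ ε ⊎ x ≈ - ε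
  x*x≈1⇒x≈±ε x xx≈1 =
    [ (λ eq → inj₁ (trans unscale (trans (*-congʳ eq) (*-identityˡ ε))))
    , (λ eq → inj₂ (trans unscale (trans (*-congʳ eq) (-1*x≈-x ε)))) ]′
    (x*x≈1⇒x≈±1 (x * ε) (begin
      (x * ε) * (x * ε)  ≈⟨ solve 2 (λ x e → (x :* e) :* (x :* e) := (x :* x) :* (e :* e))
                              refl x ε ⟩
      (x * x) * (ε * ε)  ≈⟨ *-cong xx≈1 ε*ε≈1 ⟩
      1# * 1#            ≈⟨ *-identityˡ 1# ⟩
      1#                 ∎))
    where
    unscale : x ≈ (x * ε) * ε
    unscale = begin
      x            ≈⟨ *-identityʳ x ⟨
      x * 1#       ≈⟨ *-congˡ ε*ε≈1 ⟨
      x * (ε * ε)  ≈⟨ *-assoc x ε ε ⟨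
      (x * ε) * ε  ∎

  -- The permutation criterion

  f : Carrier → Carrier → Carrier
  f a x = x ^ n * (χ x + a)

  f-cong : ∀ a → Congruent _≈_ _≈_ (f a)
  f-cong a x≈y = *-cong (^-congˡ n x≈y) (+-congʳ (χ-cong x≈y))

  f-zero : ∀ a {x} → x ≈ 0# → f a x ≈ 0#
  f-zero a {x} x≈0 = begin
    x * x ^ n′ * (χ x + a)   ≈⟨ *-congʳ (*-congʳ x≈0) ⟩
    0# * x ^ n′ * (χ x + a)  ≈⟨ *-congʳ (zeroˡ _) ⟩
    0# * (χ x + a)           ≈⟨ zeroˡ _ ⟩
    0#                       ∎

  -- On the class χ x = s, the value of χ at the image is sⁿ χ (s + a): that is χ (1 + a) for s = 1
  -- and ε χ (-1 + a) for s = -1. These are nonzero and distinct exactly when the product χ (1 + a)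
  -- χ (-1 + a) is -ε. As -ε is nonzero, the condition excludes a = 1 and a = -1 by itself.
  Criterion : Carrier → Set ℓ
  Criterion a = χ ((1# + a) * (- 1# + a)) ≈ - ε

  χ[x^n] : ∀ {x s} → χ x ≈ s → χ (x ^ n) ≈ s ^ n
  χ[x^n] {x} χx≈s = trans (^-comm x n m) (^-congˡ n χx≈s)

  module _ {a} (crit : Criterion a) where
    private
      v≉0 : ¬ (1# + a) * (- 1# + a) ≈ 0#
      v≉0 = χ-nonzero⇒nonzero crit -ε≉0
      1+a≉0 : ¬ 1# + a ≈ 0#
      1+a≉0 eq = v≉0 (trans (*-congʳ eq) (zeroˡ _))
      -1+a≉0 : ¬ - 1# + a ≈ 0#
      -1+a≉0 eq = v≉0 (trans (*-congˡ eq) (zeroʳ _))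

    factor-nonzero : ∀ {x} → ¬ x ≈ 0# → ¬ χ x + a ≈ 0#
    factor-nonzero x≉0 eq = [ (λ χ≈1  → 1+a≉0  (trans (+-congʳ (sym χ≈1)) eq))
                            , (λ χ≈-1 → -1+a≉0 (trans (+-congʳ (sym χ≈-1)) eq)) ]′ (χ≈±1 x≉0)

    f-nonzero : ∀ {x} → ¬ x ≈ 0# → ¬ f a x ≈ 0#
    f-nonzero x≉0 = *-nonzero (^-nonzero n x≉0) (factor-nonzero x≉0)

    -- Applying χ to a common value gives χ (1 + a) = ε χ (-1 + a), and multiplying by χ (-1 + a)
    -- makes the criterion's left side ε instead of -ε.
    f-separates : ∀ {x y} → χ x ≈ 1# → χ y ≈ - 1# → ¬ f a x ≈ f a y
    f-separates {x} {y} χx≈1 χy≈-1 fx≈fy = ε≉-ε (begin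
      ε                                          ≈⟨ *-identityʳ ε ⟨
      ε * 1#                                     ≈⟨ *-congˡ (χ-square -1+a≉0) ⟨
      ε * (χ (- 1# + a) * χ (- 1# + a))          ≈⟨ *-assoc _ _ _ ⟨
      ε * χ (- 1# + a) * χ (- 1# + a)            ≈⟨ *-congʳ images ⟨
      χ (1# + a) * χ (- 1# + a)                  ≈⟨ χ-* _ _ ⟨
      χ ((1# + a) * (- 1# + a))                  ≈⟨ crit ⟩
      - ε                                        ∎)
      where
      images : χ (1# + a) ≈ ε * χ (- 1# + a)
      images = begin
        χ (1# + a)                  ≈⟨ *-identityˡ _ ⟨
        1# * χ (1# + a)             ≈⟨ *-congʳ (trans (χ[x^n] χx≈1) (1^ n)) ⟨
        χ (x ^ n) * χ (1# + a)      ≈⟨ χ-* _ _ ⟨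
        χ (x ^ n * (1# + a))        ≈⟨ χ-cong (*-congˡ (+-congʳ χx≈1)) ⟨
        χ (f a x)                   ≈⟨ χ-cong fx≈fy ⟩
        χ (f a y)                   ≈⟨ χ-cong (*-congˡ (+-congʳ χy≈-1)) ⟩
        χ (y ^ n * (- 1# + a))      ≈⟨ χ-* _ _ ⟩
        χ (y ^ n) * χ (- 1# + a)    ≈⟨ *-congʳ (χ[x^n] χy≈-1) ⟩
        ε * χ (- 1# + a)            ∎

    f-injective-on-classes : ∀ {x y} → ¬ y ≈ 0# → χ x ≈ χ y → f a x ≈ f a y → x ≈ y
    f-injective-on-classes {x} {y} y≉0 χx≈χy fx≈fy =
      ^n-injective y≉0 χx≈χy (*-cancelʳ (factor-nonzero y≉0)
        (trans (*-congˡ (+-congʳ (sym χx≈χy))) fx≈fy))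

    f-injective : Injective _≈_ _≈_ (f a)
    f-injective {x} {y} fx≈fy with x ≟ 0# | y ≟ 0#
    ... | yes x≈0 | yes y≈0 = trans x≈0 (sym y≈0)
    ... | yes x≈0 | no y≉0  =
      contradiction (trans (sym fx≈fy) (f-zero a x≈0)) (f-nonzero y≉0)
    ... | no x≉0  | yes y≈0 =
      contradiction (trans fx≈fy (f-zero a y≈0)) (f-nonzero x≉0)
    ... | no x≉0  | no y≉0  =
      [ (λ x₊ → [ (λ y₊ → f-injective-on-classes y≉0 (trans x₊ (sym y₊)) fx≈fy)
                , (λ y₋ → contradiction fx≈fy (f-separates x₊ y₋)) ]′ (χ≈±1 y≉0))
      , (λ x₋ → [ (λ y₊ → contradiction (sym fx≈fy) (f-separates y₊ x₋))
                , (λ y₋ → f-injective-on-classes y≉0 (trans x₋ (sym y₋)) fx≈fy) ]′ (χ≈±1 y≉0))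
      ]′ (χ≈±1 x≉0)

  module _ {a} (inj : Injective _≈_ _≈_ (f a)) where
    private
      g  = proj₁ ∃-nonresidue
      χg = proj₂ ∃-nonresidue
      g≉0 : ¬ g ≈ 0#
      g≉0 = χ-nonzero⇒nonzero χg -1≉0

      f-kernel : ∀ {x} → f a x ≈ 0# → x ≈ 0#
      f-kernel eq = inj (trans eq (sym (f-zero a refl)))

      -- If a were -1, then `f a` would send 1 to 0 as well as 0; if a were 1, it would do so with
      -- the nonresidue `g`.
      1+a≉0 : ¬ 1# + a ≈ 0#
      1+a≉0 eq = 1≉0 (f-kernel (trans (*-congˡ (trans (+-congʳ (1^ m)) eq)) (zeroʳ _)))

      -1+a≉0 : ¬ - 1# + a ≈ 0#
      -1+a≉0 eq = g≉0 (f-kernel (trans (*-congˡ (trans (+-congʳ χg) eq)) (zeroʳ _)))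

      -- If χ takes the value ε, then gⁿ (a − 1) / (a + 1) is a residue, so it is
      -- xⁿ for a residue x, and f takes the same value at x and at g.
      w : Carrier
      w = g ^ n * ((- 1# + a) * inv (1# + a))

      χw : χ ((1# + a) * (- 1# + a)) ≈ ε → χ w ≈ 1#
      χw eq = begin
        χ w                                                ≈⟨ χ-* _ _ ⟩
        χ (g ^ n) * χ ((- 1# + a) * inv (1# + a))          ≈⟨ *-cong (χ[x^n] χg) (χ-* _ _) ⟩
        ε * (χ (- 1# + a) * χ (inv (1# + a)))              ≈⟨ *-congˡ (*-congˡ (χ-inv 1+a≉0)) ⟩
        ε * (χ (- 1# + a) * χ (1# + a))                    ≈⟨ *-congˡ (*-comm _ _) ⟩
        ε * (χ (1# + a) * χ (- 1# + a))                    ≈⟨ *-congˡ (χ-* _ _) ⟨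
        ε * χ ((1# + a) * (- 1# + a))                      ≈⟨ *-congˡ eq ⟩
        ε * ε                                              ≈⟨ ε*ε≈1 ⟩
        1#                                                 ∎

      collision : ∀ {x} → χ x ≈ 1# → x ^ n ≈ w → f a x ≈ f a g
      collision {x} χx xⁿ≈w = begin
        x ^ n * (χ x + a)                                    ≈⟨ *-cong xⁿ≈w (+-congʳ χx) ⟩
        g ^ n * ((- 1# + a) * inv (1# + a)) * (1# + a)       ≈⟨ solve 4
          (λ g v i p → g :* (v :* i) :* p := g :* v :* (i :* p)) refl
          (g ^ n) (- 1# + a) (inv (1# + a)) (1# + a) ⟩
        g ^ n * (- 1# + a) * (inv (1# + a) * (1# + a))       ≈⟨ *-congˡ (inv-inverseˡ 1+a≉0) ⟩
        g ^ n * (- 1# + a) * 1#                              ≈⟨ *-identityʳ _ ⟩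
        g ^ n * (- 1# + a)                                   ≈⟨ *-congˡ (+-congʳ χg) ⟨
        g ^ n * (χ g + a)                                    ∎

      χ≉ε : ¬ χ ((1# + a) * (- 1# + a)) ≈ ε
      χ≉ε eq = 1≉-1 (trans (sym χx) (trans (χ-cong (inj (collision χx xⁿ≈w))) χg))
        where
        χx   = proj₁ (proj₂ (residue-root (χw eq)))
        xⁿ≈w = proj₂ (proj₂ (residue-root (χw eq)))

    f-injective⇒criterion : Criterion a
    f-injective⇒criterion = [ (λ eq → contradiction eq χ≉ε) , id ]′
      (x*x≈1⇒x≈±ε _ (χ-square (*-nonzero 1+a≉0 -1+a≉0)))

  binomial : Carrier → Polynomial
  binomial a = X ↑ n ⊗ (X ↑ m ⊕ const a)

  eval≈f : ∀ a x → eval (binomial a) x ≈ f a x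
  eval≈f a x = eval-binomial n m a x

  criterion⇒permutation : ∀ {a} → Criterion a → IsPermutationPolynomial (binomial a)
  criterion⇒permutation {a} crit =
    injective , injective⇒surjective _ (eval-congʳ (binomial a)) injective
    where
    injective : Injective _≈_ _≈_ (eval (binomial a))
    injective eq = f-injective crit (trans (sym (eval≈f a _)) (trans eq (eval≈f a _)))

  permutation⇒criterion : ∀ {a} → IsPermutationPolynomial (binomial a) → Criterion a
  permutation⇒criterion {a} (injective , _) = f-injective⇒criterion
    (λ eq → injective (trans (eval≈f a _) (trans eq (sym (eval≈f a _)))))

  criterion? : ∀ a → Dec (Criterion a)
  criterion? a = χ ((1# + a) * (- 1# + a)) ≟ (- ε)

  criterion-cong : ∀ {a b} → a ≈ b → Criterion a → Criterion b
  criterion-cong a≈b = trans (χ-cong (*-cong (+-congˡ (sym a≈b)) (+-congˡ (sym a≈b))))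

  -- Counting the solutions of the criterion

  -- a ↦ 1 + 2 / (a − 1) = (a + 1) / (a − 1), with 1 ↦ 1 since inv 0 ≈ 0.
  möbius : Inverse setoid setoid
  möbius = Composition.inverse (translation (- 1#)) (Composition.inverse inversion
             (Composition.inverse (scaling 2≉0) (translation 1#)))

  φ : Carrier → Carrier
  φ = Inverse.to möbius

  -- The quotient (1 + a) / v and the product (1 + a) v differ by the factor v², on which χ is 1.
  χφ : ∀ {a} → ¬ a ≈ 1# → χ (φ a) ≈ χ ((1# + a) * (- 1# + a))
  χφ {a} a≉1 = begin
    χ (φ a)                          ≈⟨ *-identityʳ _ ⟨
    χ (φ a) * 1#                     ≈⟨ *-congˡ (χ-square v≉0) ⟨
    χ (φ a) * (χ v * χ v)            ≈⟨ *-assoc _ _ _ ⟨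
    χ (φ a) * χ v * χ v              ≈⟨ *-congʳ (χ-* _ _) ⟨
    χ (φ a * v) * χ v                ≈⟨ *-congʳ (χ-cong φ[a]v) ⟩
    χ (1# + a) * χ v                 ≈⟨ χ-* _ _ ⟨
    χ ((1# + a) * v)                 ∎
    where
    v = - 1# + a
    v≉0 : ¬ v ≈ 0#
    v≉0 eq = a≉1 (-x+y≈0⇒y≈x 1# a eq)
    φ[a]v : φ a * v ≈ 1# + a
    φ[a]v = begin
      (1# + (1# + 1#) * inv v) * v       ≈⟨ solve 2
        (λ i v → (con 1 :+ (con 1 :+ con 1) :* i) :* v := v :+ (i :* v :+ i :* v))
        refl (inv v) v ⟩
      v + (inv v * v + inv v * v)        ≈⟨ +-congˡ (+-cong (inv-inverseˡ v≉0) (inv-inverseˡ v≉0)) ⟩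
      v + (1# + 1#)                      ≈⟨ solve 1 (λ v → v :+ (con 1 :+ con 1) :=
                                                        con 1 :+ (con 1 :+ v)) refl v ⟩
      1# + (1# + (- 1# + a))             ≈⟨ +-congˡ (x+[-x+y]≈y 1# a) ⟩
      1# + a                             ∎

  #criterion : ℕ
  #criterion = count criterion?

  -- At a = 1 the criterion fails, its left side being χ 0 = 0, whereas φ 1 = 1 has χ = 1. The
  -- second conjunct says whether that value is the one being counted. Adding this indicator to the
  -- criterion's avoids truncated subtraction.
  pole? : ∀ a → Dec (a ≈ 1# × 1# ≈ - ε)
  pole? a = (a ≟ 1#) ×-dec (1# ≟ (- ε))

  criterion-or-pole : ∀ a → 𝟙 (criterion? a) ℕ.+ 𝟙 (pole? a) ≡ 𝟙 (χ (φ a) ≟ (- ε))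
  criterion-or-pole a = by-cases (a ≟ 1#)
    where
    by-cases : Dec (a ≈ 1#) → 𝟙 (criterion? a) ℕ.+ 𝟙 (pole? a) ≡ 𝟙 (χ (φ a) ≟ (- ε))
    by-cases (no a≉1) = ≡.trans
      (≡.cong₂ ℕ._+_
        (𝟙-cong (criterion? a) (χ (φ a) ≟ (- ε)) (trans (χφ a≉1)) (trans (sym (χφ a≉1))))
        (𝟙-no (pole? a) (a≉1 ∘ proj₁)))
      (ℕ.+-identityʳ _)
    by-cases (yes a≈1) = ≡.cong₂ ℕ._+_
      (𝟙-no (criterion? a) (λ crit →
        χ-nonzero⇒nonzero crit -ε≉0 (trans (*-congˡ -1+a≈0) (zeroʳ _))))
      (𝟙-cong (pole? a) (χ (φ a) ≟ (- ε))
        (λ (_ , 1≈-ε) → trans χφ≈1 1≈-ε) (λ χφ≈-ε → a≈1 , trans (sym χφ≈1) χφ≈-ε))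
      where
      -1+a≈0 : - 1# + a ≈ 0#
      -1+a≈0 = trans (+-congˡ a≈1) (-‿inverseˡ 1#)
      φ≈1 : φ a ≈ 1#
      φ≈1 = trans (+-congˡ (trans (*-congˡ (inv-zero -1+a≈0)) (zeroʳ _))) (+-identityʳ 1#)
      χφ≈1 : χ (φ a) ≈ 1#
      χφ≈1 = trans (χ-cong φ≈1) (1^ m)

  #pole : #.∑ᴬ (λ a → 𝟙 (pole? a)) ≡ 𝟙 (1# ≟ (- ε))
  #pole = ≡.trans
    (#.∑ᴬ-split (λ a → 𝟙 (pole? a))
      (λ {x} {y} x≈y → 𝟙-cong (pole? x) (pole? y)
        (λ (eq , s) → trans (sym x≈y) eq , s) (λ (eq , s) → trans x≈y eq , s))
      1# 0 (λ a a≉1 → 𝟙-no (pole? a) (a≉1 ∘ proj₁)))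
    (≡.trans
      (≡.cong₂ ℕ._+_ (𝟙-cong (pole? 1#) (1# ≟ (- ε)) proj₂ (refl ,_))
        (Sum.sum-replicate-zero ℕ.+-0-commutativeMonoid (2 ℕ.* m)))
      (ℕ.+-identityʳ _))

  #criterion+pole≡m : #criterion ℕ.+ 𝟙 (1# ≟ (- ε)) ≡ m
  #criterion+pole≡m = begin′
    #criterion ℕ.+ 𝟙 (1# ≟ (- ε))          ≡⟨ ≡.cong₂ ℕ._+_ (count≡∑ᴬ card criterion?) (≡.sym #pole) ⟩
    #.∑ᴬ C ℕ.+ #.∑ᴬ P                      ≡⟨ #.∑ᴬ-distrib C P ⟨
    #.∑ᴬ (λ a → C a ℕ.+ P a)               ≡⟨ #.∑ᴬ-cong criterion-or-pole ⟩
    #.∑ᴬ (λ a → 𝟙 (χ (φ a) ≟ (- ε)))       ≡⟨ #.∑ᴬ-reindex _ (𝟙-χ-cong (- ε)) möbius ⟨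
    #χ≈ (- ε)                              ≡⟨ #χ≈±1 -ε≈±1 ⟩
    m                                      ∎′
    where
    open ≡.≡-Reasoning using (step-≡-⟩; step-≡-⟨) renaming (begin_ to begin′_; _∎ to _∎′)
    C P : Carrier → ℕ
    C a = 𝟙 (criterion? a)
    P a = 𝟙 (pole? a)

  -- Counting needs a decision procedure, and the criterion supplies one as a single equality test.
  -- Both directions are the identity on elements, since equality on the subsets ignores proofs.
  permutation↔criterion :
    Inverse (Subsetoid setoid (λ a → IsPermutationPolynomial (binomial a)))
            (Subsetoid setoid Criterion)
  permutation↔criterion = record
    { to        = λ (a , perm) → a , permutation⇒criterion perm
    ; from      = λ (a , crit) → a , criterion⇒permutation crit
    ; to-cong   = id
    ; from-cong = id
    ; inverse   = id , id }

  permutation-cardinality :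
    HasCardinality (Subsetoid setoid (λ a → IsPermutationPolynomial (binomial a))) #criterion
  permutation-cardinality = Composition.inverse permutation↔criterion
    (subset-cardinality criterion? criterion-cong)

  -- If ε = 1 then -ε = -1, the point a = 1 contributes nothing, and the count is m. If ε = -1 then
  -- -ε = 1 and that point is subtracted, leaving m - 1.
  #criterion-value : + (#criterion ℕ.* 2) ≡ (+ suc (2 ℕ.* m)) ℤ.- (+ 2) ℤ.+ -1ℤ ℤ.^ n
  #criterion-value = [ even , odd ]′ (sign n)
    where
    even : ε ≈ 1# × -1ℤ ℤ.^ n ≡ + 1 → _
    even (ε≈1 , eqℤ) = ≡.trans (≡.cong (λ k → + (k ℕ.* 2)) #≡m)
      (≡.trans (numerator-even m′) (≡.cong (numerator m) (≡.sym eqℤ)))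
      where
      #≡m : #criterion ≡ m
      #≡m = ≡.trans (≡.sym (ℕ.+-identityʳ _))
        (≡.trans (≡.cong (#criterion ℕ.+_) (≡.sym (𝟙-no (1# ≟ (- ε))
                   (λ 1≈-ε → 1≉-1 (trans 1≈-ε (-‿cong ε≈1))))))
          #criterion+pole≡m)
    odd : ε ≈ - 1# × -1ℤ ℤ.^ n ≡ -1ℤ → _
    odd (ε≈-1 , eqℤ) = ≡.trans (≡.cong (λ k → + (k ℕ.* 2)) #≡m′)
      (≡.trans (numerator-odd m′) (≡.cong (numerator m) (≡.sym eqℤ)))
      where
      #≡m′ : #criterion ≡ m′
      #≡m′ = ℕ.suc-injective (≡.trans (ℕ.+-comm 1 #criterion)
        (≡.trans (≡.cong (#criterion ℕ.+_) (≡.sym (𝟙-yes (1# ≟ (- ε))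
                   (sym (trans (-‿cong ε≈-1) (-‿involutive 1#))))))
          #criterion+pole≡m))

-- Odd prime powers and the rational form of the count

/1≡/2 : ∀ N i → + (N ℕ.* 2) ≡ i → (+ N) ℚ./ 1 ≡ i ℚ./ 2
-- Division in ℚ normalises, so the fractions are compared by cross-multiplication before
-- normalising. `mkℚᵘ` stores the denominator minus one, hence 0 and 1.
/1≡/2 N i eq = ℚ.fromℚᵘ-cong {mkℚᵘ (+ N) 0} {mkℚᵘ i 1}
  (*≡* (≡.trans (≡.sym (ℤ.pos-* N 2)) (≡.trans eq (≡.sym (ℤ.*-identityʳ i)))))

odd-^ : ∀ {p} → ¬ 2 ∣ p → ∀ k → ¬ 2 ∣ p ℕ.^ k
odd-^ 2∤p zero    2∣1 = contradiction (∣1⇒≡1 2∣1) λ ()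
odd-^ {p} 2∤p (suc k) 2∣p^k+1 with euclidsLemma p (p ℕ.^ k) prime[2] 2∣p^k+1
... | inj₁ 2∣p   = 2∤p 2∣p
... | inj₂ 2∣p^k = odd-^ 2∤p k 2∣p^k

-- Connects the exponent (q - 1)/2 of the statement with the cardinality 1 + 2m under which the
-- field is studied.
odd⇒1+2*half : ∀ q → ¬ 2 ∣ q → q ≡ suc (2 ℕ.* ((q ∸ 1) ℕ./ 2))
odd⇒1+2*half q 2∤q with q ℕ.% 2 in eq | m%n<n q 2 | m≡m%n+[m/n]*n q 2
... | 0           | _             | _    = contradiction (m%n≡0⇒n∣m q 2 eq) 2∤q
... | 1           | _             | q≡ = ≡.trans q≡ (≡.cong suc (≡.trans
  (ℕ.*-comm (q ℕ./ 2) 2)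
  (≡.cong (2 ℕ.*_) (≡.sym (≡.trans (≡.cong (λ k → (k ∸ 1) ℕ./ 2) q≡) (m*n/n≡m (q ℕ./ 2) 2))))))
... | suc (suc _) | s≤s (s≤s ()) | _

odd-field-count :
  ∀ {c ℓ} (F : CommutativeRing c ℓ) → IsField F →
  let open CommutativeRing F using (setoid)
      open Polynomials F
  in
  ∀ m → HasCardinality setoid (suc (2 ℕ.* m)) → ∀ n → n ≥ 1 → gcd n m ≡ 1 →
  ∃[ N ]
    HasCardinality
      (Subsetoid setoid (λ a → IsPermutationPolynomial (X ↑ n ⊗ (X ↑ m ⊕ const a)))) N
    × (+ N) ℚ./ 1 ≡ ((+ suc (2 ℕ.* m)) ℤ.- (+ 2) ℤ.+ -1ℤ ℤ.^ n) ℚ./ 2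
-- With m = 0 the field would have a single element, so 1 and 0 would coincide.
odd-field-count F isField zero card n _ _ =
  contradiction (to-injective (Fin-1-unique _ _)) (IsField.1≉0 isField)
  where
  open FiniteSetoid card
  Fin-1-unique : ∀ (i j : Fin 1) → i ≡ j
  Fin-1-unique zero zero = ≡.refl
odd-field-count F isField (suc m′) card (suc n′) _ gcd≡1 =
  #criterion , permutation-cardinality , /1≡/2 #criterion _ #criterion-value
  where open Binomial F isField m′ card n′ gcd≡1

theorem3p2 :
  {c ℓ : Level} (F : CommutativeRing c ℓ) → IsField F →
  let open CommutativeRing F using (setoid)
      open Polynomials F
  in
  (p k q : ℕ) → Prime p → ¬ (2 ∣ p) → k ≥ 1 → q ≡ p ℕ.^ k →
  HasCardinality setoid q →
  (n : ℕ) → n ≥ 1 → gcd n ((q ∸ 1) ℕ./ 2) ≡ 1 →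
  ∃[ N ]
    HasCardinality
      (Subsetoid setoid (λ a →
        IsPermutationPolynomial
          (X ↑ n ⊗ (X ↑ ((q ∸ 1) ℕ./ 2) ⊕ const a))))
      N
    × (+ N) ℚ./ 1 ≡ ((+ q) ℤ.- (+ 2) ℤ.+ -1ℤ ℤ.^ n) ℚ./ 2
theorem3p2 F isField p k q _ 2∤p _ q≡p^k card n n≥1 gcd≡1 =
  N , N-card , ≡.subst (λ r → (+ N) ℚ./ 1 ≡ ((+ r) ℤ.- (+ 2) ℤ.+ -1ℤ ℤ.^ n) ℚ./ 2)
                 (≡.sym q≡1+2m) N-value
  where
  q≡1+2m : q ≡ suc (2 ℕ.* ((q ∸ 1) ℕ./ 2))
  q≡1+2m = odd⇒1+2*half q (λ 2∣q → odd-^ 2∤p k (≡.subst (2 ∣_) q≡p^k 2∣q))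
  counted = odd-field-count F isField ((q ∸ 1) ℕ./ 2)
              (≡.subst (HasCardinality (CommutativeRing.setoid F)) q≡1+2m card) n n≥1 gcd≡1
  N       = proj₁ counted
  N-card  = proj₁ (proj₂ counted)
  N-value = proj₂ (proj₂ counted)
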